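{- Let $\mathcal{C}\subseteq 2^{[n]}$ and $\mathcal{D}\subseteq 2^{[m]}$ be codes and let $f:\mathcal{C}\to\mathcal{D}$ be a morphism. If $\mathcal{C}$ is convex, then the image code $f(\mathcal{C})\subseteq 2^{[m]}$ is convex and $\mathrm{mindim}(f(\mathcal{C}))\le \mathrm{mindim}(\mathcal{C})$. In particular, if $\mathcal{C}$ and $\mathcal{D}$ are isomorphic, then $\mathcal{C}$ is convex if and only if $\mathcal{D}$ is convex, and when both are convex they have the same minimal embedding dimension.
   Context: A code is a subset $\mathcal{C}\subseteq 2^{[n]}$ (a family of subsets of $[n]=\{1,\dots,n\}$); its elements are called codewords. For $\sigma\subseteq[n]$, the trunk of $\sigma$ in $\mathcal{C}$ is $\mathrm{Tk}_{\mathcal{C}}(\sigma)=\{c\in\mathcal{C}\mid \sigma\subseteq c\}$. A subset of $\mathcal{C}$ is a trunk in $\mathcal{C}$ if it is empty or equals $\mathrm{Tk}_{\mathcal{C}}(\sigma)$ for some $\sigma\subseteq[n]$. A function $f:\mathcal{C}\to\mathcal{D}$ between codes is a morphism if for every trunk $T$ in $\mathcal{D}$, the preimage $f^{ -1}(T)$ is a trunk in $\mathcal{C}$; it is an isomorphism if it has an inverse function that is also a morphism. Given sets $U_1,\dots,U_n\subseteq X$, the code of $\mathcal{U}=\{U_1,\dots,U_n\}$ in $X$ is $\mathrm{code}(\mathcal{U},X)=\{\sigma\subseteq[n]\mid \bigcap_{i\in\sigma}U_i\setminus\bigcup_{j\notin\sigma}U_j\neq\emptyset\}$, where the empty intersection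 is $X$. A code $\mathcal{C}\subseteq 2^{[n]}$ is convex if $\mathcal{C}=\mathrm{code}(\mathcal{U},X)$ for some open convex $X\subseteq\mathbb{R}^d$ and convex open sets $U_1,\dots,U_n\subseteq X$; $\mathrm{mindim}(\mathcal{C})$ is the smallest such $d$. -}

module Defs where

open import Data.Bool using (Bool; true; false; T)
import Data.Bool.Properties as Bool
open import Data.Fin using (Fin)
open import Data.Fin.Subset using (Subset; _∈_; _∉_; _⊆_)
open import Data.Fin.Subset.Properties using (anySubset?)
open import Data.Nat using (ℕ; suc)
import Data.Nat as ℕ
import Data.Nat.Properties as ℕ
open import Data.Product using (Σ; ∃; _×_; _,_; proj₁; proj₂)
open import Data.Rational using (ℚ; 0ℚ; 1ℚ; ½; ∣_∣)
import Data.Rational as ℚ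
import Data.Rational.Properties as ℚ
import Data.Rational.Solver as ℚSolver
open import Data.Sum using (_⊎_)
open import Data.Unit using (tt)
open import Data.Vec.Functional using (Vector; foldr)
open import Data.Vec.Properties using (≡-dec)
open import Function using (_∘_)
open import Function.Definitions using (StrictlyInverseˡ; StrictlyInverseʳ)
open import Level using (0ℓ)
open import Relation.Binary.PropositionalEquality
  using (_≡_; refl; sym; trans; cong; cong₂; subst)
open import Relation.Nullary using (¬_; Dec; no; ⌊_⌋)
open import Relation.Nullary.Decidable using (map′)
open import Relation.Unary using (Pred; Empty; Satisfiable; _≐_; _∩_; ∁; ⋂; ⋃; _⊢_)
import Relation.Unary as Unary

------------------------------------------------------------------------
-- Real numbers as Cauchy sequences of rationals

IsCauchy : (ℕ → ℚ) → Set
IsCauchy s = ∀ ε → 0ℚ ℚ.< ε →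
  ∃ λ N → ∀ m n → N ℕ.≤ m → N ℕ.≤ n → ∣ s m ℚ.- s n ∣ ℚ.< ε

private
  module Closure where
    open import Data.Rational
      using (_+_; _*_; _-_; -_; 1/_; _<_; _≤_; positive)
    open ℚSolver.+-*-Solver using (solve; _:=_; _:+_; _:*_; :-_)
    open ℚ.≤-Reasoning

    abstract
      const : ∀ q → IsCauchy (λ _ → q)
      const q ε 0<ε = 0 , λ _ _ _ _ →
        subst (λ x → ∣ x ∣ < ε) (sym (ℚ.+-inverseʳ q)) 0<ε

      half⁺ : ∀ {ε} → 0ℚ < ε → 0ℚ < ½ * ε
      half⁺ {ε} 0<ε = begin-strict
        0ℚ      ≡⟨ ℚ.*-zeroʳ ½ ⟨
        ½ * 0ℚ  <⟨ ℚ.*-monoʳ-<-pos ½ 0<ε ⟩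
        ½ * ε   ∎

      halves : ∀ ε → ½ * ε + ½ * ε ≡ ε
      halves ε = trans (sym (ℚ.*-distribʳ-+ ε ½ ½)) (ℚ.*-identityˡ ε)

      add : ∀ s t → IsCauchy s → IsCauchy t → IsCauchy (λ n → s n + t n)
      add s t cs ct ε 0<ε with cs (½ * ε) (half⁺ 0<ε) | ct (½ * ε) (half⁺ 0<ε)
      ... | M , hs | N , ht = M ℕ.⊔ N , λ m n m≥ n≥ → begin-strict
        ∣ (s m + t m) - (s n + t n) ∣    ≡⟨ cong ∣_∣ (rearrange (s m) (t m) (s n) (t n)) ⟩
        ∣ (s m - s n) + (t m - t n) ∣    ≤⟨ ℚ.∣p+q∣≤∣p∣+∣q∣ (s m - s n) (t m - t n) ⟩
        ∣ s m - s n ∣ + ∣ t m - t n ∣    <⟨ ℚ.+-mono-<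
             (hs m n (ℕ.m⊔n≤o⇒m≤o M N m≥) (ℕ.m⊔n≤o⇒m≤o M N n≥))
             (ht m n (ℕ.m⊔n≤o⇒n≤o M N m≥) (ℕ.m⊔n≤o⇒n≤o M N n≥)) ⟩
        ½ * ε + ½ * ε                    ≡⟨ halves ε ⟩
        ε                                ∎
        where
        rearrange : ∀ a b c d → (a + b) - (c + d) ≡ (a - c) + (b - d)
        rearrange = solve 4 (λ a b c d →
          (a :+ b) :+ (:- (c :+ d)) := (a :+ (:- c)) :+ (b :+ (:- d))) refl

      neg : ∀ s → IsCauchy s → IsCauchy (λ n → - s n)
      neg s cs ε 0<ε with cs ε 0<ε
      ... | N , hs = N , λ m n m≥ n≥ → begin-strict
        ∣ (- s m) - (- s n) ∣  ≡⟨ cong ∣_∣ (ℚ.neg-distrib-+ (s m) (- s n)) ⟨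
        ∣ - (s m - s n) ∣      ≡⟨ ℚ.∣-p∣≡∣p∣ (s m - s n) ⟩
        ∣ s m - s n ∣          <⟨ hs m n m≥ n≥ ⟩
        ε                      ∎

      bounded : ∀ {s} → IsCauchy s →
                ∃ λ B → 0ℚ < B × ∃ λ N → ∀ n → N ℕ.≤ n → ∣ s n ∣ ≤ B
      bounded {s} cs with cs 1ℚ (ℚ.positive⁻¹ 1ℚ)
      ... | N , hs = 1ℚ + ∣ s N ∣
        , ℚ.+-mono-<-≤ (ℚ.positive⁻¹ 1ℚ) (ℚ.0≤∣p∣ (s N))
        , N , λ n n≥ → begin
            ∣ s n ∣                    ≡⟨ cong ∣_∣ (split (s n) (s N)) ⟩
            ∣ (s n - s N) + s N ∣      ≤⟨ ℚ.∣p+q∣≤∣p∣+∣q∣ (s n - s N) (s N) ⟩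
            ∣ s n - s N ∣ + ∣ s N ∣    ≤⟨ ℚ.+-monoˡ-≤ ∣ s N ∣ (ℚ.<⇒≤ (hs n N n≥ ℕ.≤-refl)) ⟩
            1ℚ + ∣ s N ∣               ∎
        where
        split : ∀ a b → a ≡ (a - b) + b
        split = solve 2 (λ a b → a := (a :+ (:- b)) :+ b) refl

      divide : ∀ {B ε} → 0ℚ < B → 0ℚ < ε → ∃ λ δ → 0ℚ < δ × B * δ ≡ ε
      divide {B} {ε} 0<B 0<ε = δ , 0<δ , (begin-equality
          B * (1/ B * ε)  ≡⟨ ℚ.*-assoc B (1/ B) ε ⟨
          (B * 1/ B) * ε  ≡⟨ cong (_* ε) (ℚ.*-inverseʳ B) ⟩
          1ℚ * ε          ≡⟨ ℚ.*-identityˡ ε ⟩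
          ε               ∎)
        where
        instance
          B⁺ : ℚ.Positive B
          B⁺ = positive 0<B
          B≢0 : ℚ.NonZero B
          B≢0 = ℚ.pos⇒nonZero B
          B⁻¹⁺ : ℚ.Positive (1/ B)
          B⁻¹⁺ = ℚ.1/pos⇒pos B
        δ : ℚ
        δ = 1/ B * ε
        0<δ : 0ℚ < δ
        0<δ = begin-strict
          0ℚ         ≡⟨ ℚ.*-zeroʳ (1/ B) ⟨
          1/ B * 0ℚ  <⟨ ℚ.*-monoʳ-<-pos (1/ B) 0<ε ⟩
          δ          ∎

      scale : ∀ {B δ} x y → 0ℚ < B → ∣ x ∣ ≤ B → ∣ y ∣ < δ → ∣ x * y ∣ < B * δ
      scale {B} {δ} x y 0<B x≤B y<δ = begin-strict
          ∣ x * y ∣      ≡⟨ ℚ.∣p*q∣≡∣p∣*∣q∣ x y ⟩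
          ∣ x ∣ * ∣ y ∣  ≤⟨ ℚ.*-monoʳ-≤-nonNeg ∣ y ∣ x≤B ⟩
          B * ∣ y ∣      <⟨ ℚ.*-monoʳ-<-pos B y<δ ⟩
          B * δ          ∎
        where
        instance
          B⁺ : ℚ.Positive B
          B⁺ = positive 0<B
          ∣y∣⁺ : ℚ.NonNegative ∣ y ∣
          ∣y∣⁺ = ℚ.∣-∣-nonNeg y

      mul-diff : ∀ {A B α β ε} a b c d → 0ℚ < A → 0ℚ < B →
                 A * β ≡ ½ * ε → B * α ≡ ½ * ε →
                 ∣ a ∣ ≤ A → ∣ d ∣ ≤ B → ∣ a - c ∣ < α → ∣ b - d ∣ < β →
                 ∣ a * b - c * d ∣ < ε
      mul-diff {A} {B} {α} {β} {ε} a b c d 0<A 0<B Aβ≡ Bα≡ a≤A d≤B ac<α bd<β = begin-strict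
          ∣ a * b - c * d ∣                  ≡⟨ cong ∣_∣ (rearrange a b c d) ⟩
          ∣ a * (b - d) + d * (a - c) ∣      ≤⟨ ℚ.∣p+q∣≤∣p∣+∣q∣ (a * (b - d)) (d * (a - c)) ⟩
          ∣ a * (b - d) ∣ + ∣ d * (a - c) ∣  <⟨ ℚ.+-mono-< (scale a (b - d) 0<A a≤A bd<β)
                                                          (scale d (a - c) 0<B d≤B ac<α) ⟩
          A * β + B * α                      ≡⟨ cong₂ _+_ Aβ≡ Bα≡ ⟩
          ½ * ε + ½ * ε                      ≡⟨ halves ε ⟩
          ε                                  ∎
        where
        rearrange : ∀ a b c d → a * b - c * d ≡ a * (b - d) + d * (a - c)
        rearrange = solve 4 (λ a b c d →
          (a :* b) :+ (:- (c :* d)) :=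
          (a :* (b :+ (:- d))) :+ (d :* (a :+ (:- c)))) refl

      mul : ∀ s t → IsCauchy s → IsCauchy t → IsCauchy (λ n → s n * t n)
      mul s t cs ct ε 0<ε =
        let A , 0<A , K , s≤A = bounded cs
            B , 0<B , L , t≤B = bounded ct
            α , 0<α , Bα≡     = divide 0<B (half⁺ 0<ε)
            β , 0<β , Aβ≡     = divide 0<A (half⁺ 0<ε)
            M , hs            = cs α 0<α
            N , ht            = ct β 0<β
        in (K ℕ.⊔ L) ℕ.⊔ (M ℕ.⊔ N) , λ m n m≥ n≥ →
          let KL≤m = ℕ.m⊔n≤o⇒m≤o (K ℕ.⊔ L) (M ℕ.⊔ N) m≥
              KL≤n = ℕ.m⊔n≤o⇒m≤o (K ℕ.⊔ L) (M ℕ.⊔ N) n≥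
              MN≤m = ℕ.m⊔n≤o⇒n≤o (K ℕ.⊔ L) (M ℕ.⊔ N) m≥
              MN≤n = ℕ.m⊔n≤o⇒n≤o (K ℕ.⊔ L) (M ℕ.⊔ N) n≥
          in mul-diff (s m) (t m) (s n) (t n) 0<A 0<B Aβ≡ Bα≡
               (s≤A m (ℕ.m⊔n≤o⇒m≤o K L KL≤m))
               (t≤B n (ℕ.m⊔n≤o⇒n≤o K L KL≤n))
               (hs m n (ℕ.m⊔n≤o⇒m≤o M N MN≤m) (ℕ.m⊔n≤o⇒m≤o M N MN≤n))
               (ht m n (ℕ.m⊔n≤o⇒n≤o M N MN≤m) (ℕ.m⊔n≤o⇒n≤o M N MN≤n))

record ℝ : Set where
  constructor mkℝ
  field
    seq    : ℕ → ℚ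
    cauchy : IsCauchy seq
open ℝ public

infix  8 -_
infixl 7 _*_
infixl 6 _+_ _-_
infix  4 _<_ _≤_

fromℚ : ℚ → ℝ
fromℚ q = mkℝ (λ _ → q) (Closure.const q)

0ℝ 1ℝ : ℝ
0ℝ = fromℚ 0ℚ
1ℝ = fromℚ 1ℚ

-_ : ℝ → ℝ
- mkℝ s cs = mkℝ (λ n → ℚ.- s n) (Closure.neg s cs)

_+_ _*_ _-_ : ℝ → ℝ → ℝ
mkℝ s cs + mkℝ t ct = mkℝ (λ n → s n ℚ.+ t n) (Closure.add s t cs ct)
mkℝ s cs * mkℝ t ct = mkℝ (λ n → s n ℚ.* t n) (Closure.mul s t cs ct)
x - y = x + (- y)

-- The uniform gap ε makes this the order of the limits; termwise strict
-- inequality alone would not be.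
_<_ : ℝ → ℝ → Set
x < y = ∃ λ ε → 0ℚ ℚ.< ε × ∃ λ N → ∀ n → N ℕ.≤ n → seq x n ℚ.+ ε ℚ.≤ seq y n

_≤_ : ℝ → ℝ → Set
x ≤ y = ¬ (y < x)

------------------------------------------------------------------------
-- Open and convex subsets of ℝᵈ

ℝ^ : ℕ → Set
ℝ^ d = Vector ℝ d

dist² : ∀ {d} → ℝ^ d → ℝ^ d → ℝ
dist² x y = foldr _+_ 0ℝ λ i → (x i - y i) * (x i - y i)

-- Points are represented by Cauchy sequences.  An open set is automatically
-- invariant under change of representative, since representatives of the same
-- point are at distance below every ε > 0.
IsOpen : ∀ {d} → Pred (ℝ^ d) 0ℓ → Set
IsOpen S = ∀ x → S x →
  ∃ λ ε → 0ℝ < ε × (∀ y → dist² x y < ε * ε → S y)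

IsConvex : ∀ {d} → Pred (ℝ^ d) 0ℓ → Set
IsConvex S = ∀ x y → S x → S y → ∀ t → 0ℝ ≤ t → t ≤ 1ℝ →
  S (λ i → (1ℝ - t) * x i + t * y i)

------------------------------------------------------------------------
-- Codes and morphisms

-- A family of subsets of [n], given by its characteristic function, just as
-- a Subset n is.
Code : ℕ → Set
Code n = Subset n → Bool

infix 4 _∈ᶜ_
_∈ᶜ_ : ∀ {n} → Subset n → Code n → Set
σ ∈ᶜ C = T (C σ)

Codeword : ∀ {n} → Code n → Set
Codeword C = Σ (Subset _) (_∈ᶜ C)

Tk : ∀ {n} (C : Code n) → Subset n → Pred (Codeword C) 0ℓ
Tk C σ c = σ ⊆ proj₁ c

IsTrunk : ∀ {n} (C : Code n) → Pred (Codeword C) 0ℓ → Set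
IsTrunk C S = Empty S ⊎ ∃ λ σ → S ≐ Tk C σ

module _ {n m : ℕ} (C : Code n) (D : Code m) where

  IsMorphism : (Codeword C → Codeword D) → Set₁
  IsMorphism f = ∀ S → IsTrunk D S → IsTrunk C (f ⊢ S)

  InImage : (Codeword C → Codeword D) → Subset m → Set
  InImage f τ = ∃ λ c → proj₁ (f c) ≡ τ

  inImage? : ∀ f τ → Dec (InImage f τ)
  inImage? f τ =
    map′ (λ (σ , p , eq) → (σ , p) , eq) (λ ((σ , p) , eq) → σ , p , eq)
      (anySubset? λ σ → T-any? (C σ) λ p → ≡-dec Bool._≟_ (proj₁ (f (σ , p))) τ)
    where
    T-any? : ∀ b {P : T b → Set} → (∀ p → Dec (P p)) → Dec (∃ P)
    T-any? true  P? = map′ (tt ,_) proj₂ (P? tt)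
    T-any? false P? = no proj₁

  image : (Codeword C → Codeword D) → Code m
  image f τ = ⌊ inImage? f τ ⌋

infix 4 _≅_
_≅_ : ∀ {n m} → Code n → Code m → Set₁
C ≅ D = ∃ λ (f : Codeword C → Codeword D) → IsMorphism C D f ×
        ∃ λ (g : Codeword D → Codeword C) → IsMorphism D C g ×
        StrictlyInverseˡ _≡_ f g × StrictlyInverseʳ _≡_ f g

------------------------------------------------------------------------
-- Convex codes

atom : ∀ {n d} → Vector (Pred (ℝ^ d) 0ℓ) n → Pred (ℝ^ d) 0ℓ → Subset n → Pred (ℝ^ d) 0ℓ
atom U X σ = X ∩ ⋂ (∃ (_∈ σ)) (U ∘ proj₁) ∩ ∁ (⋃ (∃ (_∉ σ)) (U ∘ proj₁))

code : ∀ {n d} → Vector (Pred (ℝ^ d) 0ℓ) n → Pred (ℝ^ d) 0ℓ → Pred (Subset n) 0ℓ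
code U X σ = Satisfiable (atom U X σ)

record ConvexIn {n} (d : ℕ) (C : Code n) : Set₁ where
  field
    X        : Pred (ℝ^ d) 0ℓ
    U        : Vector (Pred (ℝ^ d) 0ℓ) n
    X-open   : IsOpen X
    X-convex : IsConvex X
    U⊆X      : ∀ i → U i Unary.⊆ X
    U-open   : ∀ i → IsOpen (U i)
    U-convex : ∀ i → IsConvex (U i)
    realizes : (_∈ᶜ C) ≐ code U X

Convex : ∀ {n} → Code n → Set₁
Convex C = ∃ λ d → ConvexIn d C

-- Finding the least dimension is not computable in general, so mindim is a
-- relation rather than a function; the two lemmas below show that it is
-- single-valued and, classically, defined on all convex codes.
IsMindim : ∀ {n} → Code n → ℕ → Set₁
IsMindim C d = ConvexIn d C × (∀ e → ConvexIn e C → d ℕ.≤ e)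

IsMindim-unique : ∀ {n} {C : Code n} {d e} → IsMindim C d → IsMindim C e → d ≡ e
IsMindim-unique (cd , d≤) (ce , e≤) = ℕ.≤-antisym (d≤ _ ce) (e≤ _ cd)

IsMindim-exists : ∀ {n} {C : Code n} → Convex C → ¬ ¬ ∃ (IsMindim C)
IsMindim-exists {C = C} (d , cd) none = notBelow (suc d) d ℕ.≤-refl cd
  where
  notBelow : ∀ k e → e ℕ.< k → ¬ ConvexIn e C
  notBelow (suc k) e e<1+k ce = none (e , ce , λ e′ ce′ →
    ℕ.≮⇒≥ λ e′<e → notBelow k e′ (ℕ.<-≤-trans e′<e (ℕ.s≤s⁻¹ e<1+k)) ce′)

{-# OPTIONS --safe #-}

-- If a morphism f pulls the trunk of {j} back to the trunk of σⱼ, replace the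
-- sets Uᵢ realizing the domain by Vⱼ = X ∩ ⋂_{i ∈ σⱼ} Uᵢ (and by Vⱼ = ∅ when
-- the pullback is empty).  These are again open and convex, and a point lying
-- in the atom of c with respect to U lies in Vⱼ exactly when j ∈ f(c), so the
-- code of V in the same X is the image of f.
module Submission where

open import Defs hiding (_≤_)
open import Data.Fin using (Fin; zero; suc)
open import Data.Fin.Properties using (sequence)
open import Data.Fin.Subset using (Subset; _∈_; _⊆_; ⁅_⁆; inside)
open import Data.Fin.Subset.Properties using (_∈?_; x∈⁅x⁆; x∈⁅y⁆⇒x≡y; ⊆-antisym)
open import Data.Nat using (ℕ; _≤_)
import Data.Nat as ℕ
import Data.Nat.Properties as ℕ
open import Data.Product using (∃; _×_; _,_; proj₁; proj₂)
open import Data.Rational using (0ℚ; 1ℚ; _⊓_)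
import Data.Rational as ℚ
import Data.Rational.Properties as ℚ
open import Data.Sum using (inj₁; inj₂)
open import Data.Vec using (tabulate)
open import Data.Vec.Functional using (Vector)
open import Data.Vec.Properties using (lookup∘tabulate; []=⇒lookup; lookup⇒[]=)
open import Effect.Monad using (RawMonad)
open import Function using (_∘_; _⇔_; mk⇔; Equivalence)
open import Function.Definitions using (StrictlyInverseˡ)
open import Level using (0ℓ)
open import Relation.Binary.PropositionalEquality
  using (_≡_; refl; sym; trans; cong; subst)
open import Relation.Nullary
  using (¬_; Dec; yes; no; does; contradiction; ¬¬-map; decidable-stable)
open import Relation.Nullary.Decidable using (¬¬-excluded-middle; toWitness; fromWitness; dec-true; T?)
open import Relation.Nullary.Negation using (¬¬-Monad)
open import Relation.Unary using (Pred; ∅; U; _≐_; _∩_; ⋂; _⊢_)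

open Equivalence using (to; from)

-- Each instance of excluded middle is irrefutable, and double negation commutes with finite
-- conjunctions.
¬¬-all-dec : ∀ {n} (P : Pred (Fin n) 0ℓ) → ¬ ¬ (∀ i → Dec (P i))
¬¬-all-dec _ = sequence (RawMonad.rawApplicative ¬¬-Monad) λ _ → ¬¬-excluded-middle

module _ {n} {P : Pred (Fin n) 0ℓ} (P? : ∀ i → Dec (P i)) where

  comprehension : Subset n
  comprehension = tabulate (λ i → does (P? i))

  ∈-comprehension : ∀ {i} → i ∈ comprehension ⇔ P i
  ∈-comprehension {i} = mk⇔
    (λ i∈ → decide (P? i) (trans (sym (lookup∘tabulate _ i)) ([]=⇒lookup i∈)))
    (λ p → lookup⇒[]= i _ (trans (lookup∘tabulate _ i) (dec-true (P? i) p)))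
    where
    decide : ∀ {A : Set} (A? : Dec A) → does A? ≡ inside → A
    decide (yes a) _ = a

-- Identifies the trunk of `⁅ i ⁆` with the codewords containing `i`, so singleton trunks determine
-- a codeword.
⁅⁆⊆⇔∈ : ∀ {n} {i : Fin n} {σ} → ⁅ i ⁆ ⊆ σ ⇔ i ∈ σ
⁅⁆⊆⇔∈ {i = i} {σ} = mk⇔ (λ i⊆σ → i⊆σ (x∈⁅x⁆ i))
  (λ i∈σ {_} j∈ → subst (_∈ σ) (sym (x∈⁅y⁆⇒x≡y i j∈)) i∈σ)

0<1 : 0ℝ < 1ℝ
0<1 = 1ℚ , ℚ.positive⁻¹ 1ℚ , 0 , λ _ _ → ℚ.≤-refl

-- The gap `ε` is kept; only the index from which it holds grows.
<-respʳ-eventually-≤ : ∀ {x} y z N → (∀ n → N ℕ.≤ n → seq y n ℚ.≤ seq z n) → x < y → x < z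
<-respʳ-eventually-≤ y z N y≤z (ε , 0<ε , M , h) = ε , 0<ε , M ℕ.⊔ N , λ n n≥ →
  ℚ.≤-trans (h n (ℕ.m⊔n≤o⇒m≤o M N n≥)) (y≤z n (ℕ.m⊔n≤o⇒n≤o M N n≥))

*-self-mono-≤ : ∀ {p q} → 0ℚ ℚ.< p → p ℚ.≤ q → p ℚ.* p ℚ.≤ q ℚ.* q
*-self-mono-≤ {p} {q} 0<p p≤q = ℚ.≤-trans (ℚ.*-monoʳ-≤-nonNeg p p≤q) (ℚ.*-monoˡ-≤-nonNeg q p≤q)
  where
  instance
    _ = ℚ.nonNegative (ℚ.<⇒≤ 0<p)
    _ = ℚ.nonNegative (ℚ.≤-trans (ℚ.<⇒≤ 0<p) p≤q)

-- The minimum of two reals is avoided by passing to rational lower bounds.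
common-radius : ∀ ε δ → 0ℝ < ε → 0ℝ < δ →
  ∃ λ η → 0ℝ < η × (∀ r → r < η * η → r < ε * ε × r < δ * δ)
common-radius ε δ (p , 0<p , M , p≤ε) (q , 0<q , N , q≤δ) =
  fromℚ (p ⊓ q) , (p ⊓ q , 0<p⊓q , 0 , λ _ _ → ℚ.≤-reflexive (ℚ.+-identityˡ (p ⊓ q))) ,
  λ r r<η² →
    <-respʳ-eventually-≤ {r} (η * η) (ε * ε) M
      (λ n n≥ → *-self-mono-≤ 0<p⊓q
        (ℚ.≤-trans (ℚ.p⊓q≤p p q) (subst (ℚ._≤ _) (ℚ.+-identityˡ p) (p≤ε n n≥)))) r<η² ,
    <-respʳ-eventually-≤ {r} (η * η) (δ * δ) N
      (λ n n≥ → *-self-mono-≤ 0<p⊓q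
        (ℚ.≤-trans (ℚ.p⊓q≤q p q) (subst (ℚ._≤ _) (ℚ.+-identityˡ q) (q≤δ n n≥)))) r<η²
  where
  η = fromℚ (p ⊓ q)
  0<p⊓q : 0ℚ ℚ.< p ⊓ q
  0<p⊓q with ℚ.⊓-sel p q
  ... | inj₁ eq = subst (0ℚ ℚ.<_) (sym eq) 0<p
  ... | inj₂ eq = subst (0ℚ ℚ.<_) (sym eq) 0<q

module _ {d : ℕ} where

  ∅-open : IsOpen {d} ∅
  ∅-open _ ()

  U-open : IsOpen {d} U
  U-open _ _ = 1ℝ , 0<1 , _

  IsOpen-resp-≐ : {S R : Pred (ℝ^ d) 0ℓ} → S ≐ R → IsOpen S → IsOpen R
  IsOpen-resp-≐ (S⊆R , R⊆S) S-open x Rx =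
    let ε , 0<ε , ball = S-open x (R⊆S Rx)
    in ε , 0<ε , λ y y∈ → S⊆R (ball y y∈)

  ∩-open : {S R : Pred (ℝ^ d) 0ℓ} → IsOpen S → IsOpen R → IsOpen (S ∩ R)
  ∩-open S-open R-open x (Sx , Rx) =
    let ε , 0<ε , ballS = S-open x Sx
        δ , 0<δ , ballR = R-open x Rx
        η , 0<η , η≤    = common-radius ε δ 0<ε 0<δ
    in η , 0<η , λ y y∈ →
      let inε , inδ = η≤ (dist² x y) y∈ in ballS y inε , ballR y inδ

  ⋂-Fin-open : ∀ {n} {P : Vector (Pred (ℝ^ d) 0ℓ) n} →
               (∀ i → IsOpen (P i)) → IsOpen (⋂ (Fin n) P)
  ⋂-Fin-open {ℕ.zero}  _      = IsOpen-resp-≐ ((λ _ ()) , _) U-open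
  ⋂-Fin-open {ℕ.suc n} P-open = IsOpen-resp-≐
    ((λ { (p , _) zero → p ; (_ , ps) (suc i) → ps i }) , λ ps → ps zero , ps ∘ suc)
    (∩-open (P-open zero) (⋂-Fin-open (P-open ∘ suc)))

  -- With `i ∈ σ` as `A`, an index outside `σ` contributes the whole space, so an intersection over
  -- `σ` becomes one over all of `Fin n`.
  ⇒-open : {A : Set} {S : Pred (ℝ^ d) 0ℓ} → Dec A → IsOpen S → IsOpen (λ x → A → S x)
  ⇒-open (yes a) S-open = IsOpen-resp-≐ ((λ s _ → s) , λ s → s a) S-open
  ⇒-open (no ¬a) _      = IsOpen-resp-≐ ((λ _ a → contradiction a ¬a) , _) U-open

  ⋂-∈-open : ∀ {n} {P : Vector (Pred (ℝ^ d) 0ℓ) n} (σ : Subset n) →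
             (∀ i → IsOpen (P i)) → IsOpen (⋂ (∃ (_∈ σ)) (P ∘ proj₁))
  ⋂-∈-open σ P-open = IsOpen-resp-≐
    ((λ { ps (i , i∈σ) → ps i i∈σ }) , λ ps i i∈σ → ps (i , i∈σ))
    (⋂-Fin-open λ i → ⇒-open (i ∈? σ) (P-open i))

module _ {n m} {C : Code n} {D : Code m} {E : Code m}
         (f : Codeword C → Codeword D) (morph : IsMorphism C D f)
         (E≐image : (_∈ᶜ E) ≐ InImage C D f)
         {d} (CC : ConvexIn d C) where

  open ConvexIn CC renaming (U to W; U-open to W-open; U-convex to W-convex)

  private

    -- The factor `X` matters when `σ` is empty: the bare intersection would be all of `ℝ^ d`.
    region : ∀ {S} → IsTrunk C S → Pred (ℝ^ d) 0ℓ
    region (inj₁ _)       = ∅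
    region (inj₂ (σ , _)) = X ∩ ⋂ (∃ (_∈ σ)) (W ∘ proj₁)

    region⊆X : ∀ {S} (t : IsTrunk C S) {x} → region t x → X x
    region⊆X (inj₂ _) = proj₁

    region-open : ∀ {S} (t : IsTrunk C S) → IsOpen (region t)
    region-open (inj₁ _)       = ∅-open
    region-open (inj₂ (σ , _)) = ∩-open X-open (⋂-∈-open σ W-open)

    region-convex : ∀ {S} (t : IsTrunk C S) → IsConvex (region t)
    region-convex (inj₂ _) x y (Xx , Wx) (Xy , Wy) t 0≤t t≤1 =
      X-convex x y Xx Xy t 0≤t t≤1 ,
      λ i → W-convex (proj₁ i) x y (Wx i) (Wy i) t 0≤t t≤1

    -- In the atom of `c` the sets `W i` containing `x` are those with `i ∈ c`, so lying in every
    -- `W i` with `i ∈ σ` amounts to `σ ⊆ c`.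
    region⇔∈ : ∀ {S} (t : IsTrunk C S) (c : Codeword C) {x} →
               atom W X (proj₁ c) x → region t x ⇔ S c
    region⇔∈ (inj₁ S-empty) c _ = mk⇔ (λ ()) (S-empty c)
    region⇔∈ (inj₂ (σ , S⊆Tk , Tk⊆S)) (c , _) (Xx , Wx , ∉W) = mk⇔
      -- `∉W` only refutes `i ∉ c`; decidability of `∈` turns this into membership.
      (λ (_ , Wσ) → Tk⊆S λ {i} i∈σ → decidable-stable (i ∈? c)
        λ i∉c → ∉W ((i , i∉c) , Wσ (i , i∈σ)))
      (λ Sc → Xx , λ (i , i∈σ) → Wx (i , S⊆Tk Sc i∈σ))

    trunk : ∀ j → IsTrunk C (f ⊢ Tk D ⁅ j ⁆)
    trunk j = morph (Tk D ⁅ j ⁆) (inj₂ (⁅ j ⁆ , (λ s → s) , λ s → s))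

    V : Vector (Pred (ℝ^ d) 0ℓ) m
    V j = region (trunk j)

    V⇔∈ : ∀ c {x} → atom W X (proj₁ c) x → ∀ j → V j x ⇔ j ∈ proj₁ (f c)
    V⇔∈ c ax j = mk⇔ (to ⁅⁆⊆⇔∈ ∘ to (region⇔∈ (trunk j) c ax))
                     (from (region⇔∈ (trunk j) c ax) ∘ from ⁅⁆⊆⇔∈)

    -- A point in the atom of `c` for `W` also lies in the atom of `f c` for `V`, so the witness
    -- carries over unchanged.
    image⊆code : ∀ {τ} → InImage C D f τ → code V X τ
    image⊆code (c , refl) with proj₁ realizes (proj₂ c)
    ... | x , ax = x , proj₁ ax ,
      (λ (j , j∈) → from (V⇔∈ c ax j) j∈) ,
      λ ((j , j∉) , Vx) → j∉ (to (V⇔∈ c ax j) Vx)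

    -- Deciding which W i contain x is only possible up to double negation;
    -- this suffices since membership in the image is decidable.
    code⊆image : ∀ {τ} → code V X τ → ¬ ¬ InImage C D f τ
    code⊆image {τ} (x , Xx , Vτ , ∉V) = ¬¬-map located (¬¬-all-dec (λ i → W i x))
      where
      located : (∀ i → Dec (W i x)) → InImage C D f τ
      located W? = c , ⊆-antisym
          (λ {j} j∈ → decidable-stable (j ∈? τ) λ j∉ → ∉V ((j , j∉) , from (V⇔∈ c ax j) j∈))
          (λ {j} j∈ → to (V⇔∈ c ax j) (Vτ (j , j∈)))
        where
        ax : atom W X (comprehension W?) x
        ax = Xx , (λ (_ , i∈) → to (∈-comprehension W?) i∈) ,
             λ ((_ , i∉) , Wx) → i∉ (from (∈-comprehension W?) Wx)
        -- The index set of `x` is a codeword because `x` itself lies in its atom.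
        c : Codeword C
        c = comprehension W? , proj₂ realizes (x , ax)

  -- Leaving `E` abstract lets one construction serve both `image C D f` and, for an isomorphism,
  -- `D` itself. The ambient `X`, hence `d`, is unchanged.
  image-convexIn : ConvexIn d E
  image-convexIn = record
    { X        = X
    ; U        = V
    ; X-open   = X-open
    ; X-convex = X-convex
    ; U⊆X      = λ j → region⊆X (trunk j)
    ; U-open   = λ j → region-open (trunk j)
    ; U-convex = λ j → region-convex (trunk j)
    ; realizes = image⊆code ∘ proj₁ E≐image
               -- Codes are Boolean-valued, so membership in `E` is stable and absorbs the double
               -- negation.
               , λ {τ} τ∈ → decidable-stable (T? (E τ)) (¬¬-map (proj₂ E≐image) (code⊆image τ∈))
    }

image≐InImage : ∀ {n m} (C : Code n) (D : Code m) f → (_∈ᶜ image C D f) ≐ InImage C D f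
image≐InImage C D f = toWitness , fromWitness

-- The right inverse `g` supplies a preimage of every codeword of `D`.
surjective⇒≐InImage : ∀ {n m} {C : Code n} {D : Code m} f g →
                      StrictlyInverseˡ _≡_ f g → (_∈ᶜ D) ≐ InImage C D f
surjective⇒≐InImage {D = D} f g fg =
  (λ {τ} τ∈ → g (τ , τ∈) , cong proj₁ (fg (τ , τ∈))) ,
  λ (c , eq) → subst (_∈ᶜ D) eq (proj₂ (f c))

theorem1p1 : (n m : ℕ) (C : Code n) (D : Code m) →
    ((f : Codeword C → Codeword D) → IsMorphism C D f → Convex C →
    Convex (image C D f) ×
    (∀ d e → IsMindim C d → IsMindim (image C D f) e → e ≤ d)) ×
    (C ≅ D →
    (Convex C ⇔ Convex D) ×
    (∀ d e → IsMindim C d → IsMindim D e → d ≡ e))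
theorem1p1 n m C D =
  (λ f morph (d , CC) →
    -- Generic in the dimension: it is applied both to the given realization and to one of minimal
    -- dimension.
    let push = λ {d} → image-convexIn f morph (image≐InImage C D f) {d}
    in (d , push CC) , λ _ _ (Cd , _) (_ , e≤) → e≤ _ (push Cd)) ,
  λ (f , f-morph , g , g-morph , fg , gf) →
    let C⇒D = λ {d} → image-convexIn f f-morph (surjective⇒≐InImage f g fg) {d}
        D⇒C = λ {d} → image-convexIn g g-morph (surjective⇒≐InImage g f gf) {d}
    in mk⇔ (λ (d , CC) → d , C⇒D CC) (λ (d , CD) → d , D⇒C CD) ,
       -- Each minimal realization is transported to the other code, where it bounds that code's
       -- minimum.
       λ _ _ (Cd , d≤) (De , e≤) → ℕ.≤-antisym (d≤ _ (D⇒C De)) (e≤ _ (C⇒D Cd))
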